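{- Let $n>0$. If $M\in\mathbf{DA}$ is a finite monoid generated (as a monoid) by $n$ elements, then $M\in\mathbf V_n$.
   Context: For an element $m$ of a finite monoid, $m^{\omega}$ denotes the unique idempotent among the powers of $m$ of positive exponent. $\mathbf{DA}$ is the class of finite monoids satisfying $(xyz)^{\omega}y(xyz)^{\omega}=(xyz)^{\omega}$ for all $x,y,z$. A monoid $M$ divides a monoid $N$ if $M$ is a homomorphic image of a submonoid of $N$. A pseudovariety is a class of finite monoids closed under finite direct products and division. $\mathbf{J}$ is the pseudovariety of finite monoids $M$ such that $MsM=MtM$ implies $s=t$ for all $s,t\in M$. Two-sided semidirect product: for a finite alphabet $A$ and a homomorphism $\psi:A^*\to N$ into a finite monoid, let $\Sigma=N\times A\times N$, regarded as a finite alphabet, and define $\tau_\psi:A^*\to\Sigma^*$ by $\tau_\psi(a_1\cdots a_m)=\sigma_1\cdots\sigma_m$, where $\sigma_i=(\psi(a_1\cdots a_{i-1}),a_i,\psi(a_{i+1}\cdots a_m))$ (empty products give $1$). For pseudovarieties $\mathbf V,\mathbf W$, a finite monoid $M$ belongs to $\mathbf V\mathbin{**}\mathbf W$ if and only if, for a surjective homomorphism $\phi:A^*\to M$ with $A$ a finite alphabet, there exist homomorphisms $\psi:A^*\to N$ with $N\in\mathbf W$ and $h:(N\times A\times N)^*\to K$ with $K\in\mathbf V$ such that for all $v,w\in A^*$, $\psi(v)=\psi(w)$ and $h(\tau_\psi(v))=h(\tau_\psi(w))$ imply $\phi(v)=\phi(w)$. (This does not depend on the choice of $A$ and $\phi$.)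 Set $\mathbf V_1=\mathbf J$ and $\mathbf V_{n+1}=\mathbf V_n\mathbin{**}\mathbf J$ for $n\ge1$. -}

module Defs where

open import Algebra.Bundles using (Monoid)
import Algebra.Definitions.RawMonoid as RawMonoidDefs
open import Algebra.Morphism.Structures using (module MonoidMorphisms)
open import Algebra.Structures using (IsMonoid)
open import Data.Fin.Base using (Fin; toℕ)
open import Data.List.Base
  using (List; length; lookup; take; drop; tabulate; ++-[]-rawMonoid)
open import Data.List.Effectful.Foldable using (foldMap)
open import Data.Nat.Base using (ℕ; suc; NonZero)
open import Data.Product.Base using (∃; ∃₂; _×_; _,_)
open import Function.Bundles using (_↔_)
open import Function.Definitions using (Surjective; StrictlySurjective)
open import Level using (Level; Lift; 0ℓ; _⊔_) renaming (suc to lsuc)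
open import Relation.Binary.PropositionalEquality.Core using (_≡_)
open import Relation.Unary using (Pred; _≐_)

private
  variable
    ℓ₁ ℓ₂ : Level

Finite : Set → Set
Finite A = ∃ λ k → A ↔ Fin k

record FiniteMonoid : Set₁ where
  infixl 7 _∙_
  field
    Carrier  : Set
    _∙_      : Carrier → Carrier → Carrier
    ε        : Carrier
    isMonoid : IsMonoid _≡_ _∙_ ε
    finite   : Finite Carrier

  monoid : Monoid 0ℓ 0ℓ
  monoid = record { isMonoid = isMonoid }

  open Monoid monoid public using (rawMonoid)

  infixr 8 _^_
  _^_ : Carrier → ℕ → Carrier
  m ^ k = RawMonoidDefs._×_ rawMonoid k m

  -- e = m^ω.  In a finite monoid there is exactly one such e for each m, so
  -- quantifying over all such e is the same as speaking of m^ω.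
  infix 4 _IsOmegaPowerOf_
  _IsOmegaPowerOf_ : Carrier → Carrier → Set
  e IsOmegaPowerOf m = (e ∙ e ≡ e) × ∃ λ k → e ≡ m ^ suc k

  -- The two-sided ideal M s M.
  ideal : Carrier → Pred Carrier 0ℓ
  ideal s x = ∃₂ λ u v → x ≡ u ∙ s ∙ v

open FiniteMonoid using (Carrier; rawMonoid)

DA : Pred FiniteMonoid 0ℓ
DA M = ∀ x y z e → e IsOmegaPowerOf (x ∙ y ∙ z) → e ∙ y ∙ e ≡ e
  where open FiniteMonoid M

J : Pred FiniteMonoid 0ℓ
J M = ∀ s t → ideal s ≐ ideal t → s ≡ t
  where open FiniteMonoid M

-- The generators g 0, …, g (n - 1) need not be distinct.
GeneratedBy : ℕ → Pred FiniteMonoid 0ℓ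
GeneratedBy n M =
  ∃ λ (g : Fin n → Carrier M) → StrictlySurjective _≡_ (foldMap (rawMonoid M) g)

-- Homomorphisms A* → M, with A* the monoid of lists under concatenation.
IsHom : {A : Set} (M : FiniteMonoid) → (List A → Carrier M) → Set
IsHom {A} M = IsMonoidHomomorphism
  where open MonoidMorphisms (++-[]-rawMonoid A) (rawMonoid M)

τ : {A N : Set} → (List A → N) → List A → List (N × A × N)
τ ψ w = tabulate λ (i : Fin (length w)) →
  ψ (take (toℕ i) w) , lookup w i , ψ (drop (suc (toℕ i)) w)

-- The condition on a surjection φ : A* → M is independent of A and φ.  It is
-- required here of every such φ; since M is finite, at least one exists.
infixl 6 _**_
_**_ : Pred FiniteMonoid ℓ₁ → Pred FiniteMonoid ℓ₂ →
       Pred FiniteMonoid (lsuc 0ℓ ⊔ ℓ₁ ⊔ ℓ₂)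
(V ** W) M =
  (A : Set) → Finite A →
  (φ : List A → Carrier M) → IsHom M φ → Surjective _≡_ _≡_ φ →
  ∃ λ (N : FiniteMonoid) → W N ×
  ∃ λ (ψ : List A → Carrier N) → IsHom N ψ ×
  ∃ λ (K : FiniteMonoid) → V K ×
  ∃ λ (h : List (Carrier N × A × Carrier N) → Carrier K) → IsHom K h ×
  (∀ v w → ψ v ≡ ψ w → h (τ ψ v) ≡ h (τ ψ w) → φ v ≡ φ w)

-- Defined for n ≥ 1 only.
V : (n : ℕ) .{{_ : NonZero n}} → Pred FiniteMonoid (lsuc 0ℓ)
V 1             M = Lift (lsuc 0ℓ) (J M)
V (suc (suc n)) M = (V (suc n) ** J) M

{-# OPTIONS --safe #-}

-- Let γ : B* → M be onto with |B| = n + 1.  Reading w from the left, the R-class of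
-- the prefix value falls at most |M| times, w = w₀ a₁ w₁ ⋯ aᵣ wᵣ, and in DA the letter
-- aᵢ does not occur in wᵢ₋₁, so aᵢ is found by leftmost matching of a₁ ⋯ aᵣ.  If v has
-- the same subwords of length ≤ |M| as w, then v = v₀ a₁ v₁ ⋯ aᵣ vᵣ, again by leftmost
-- matching; if moreover γ vᵢ₋₁ = γ wᵢ₋₁ for all i, then γ v ∈ γ w M.  By symmetry and
-- duality γ v and γ w are H-equivalent, hence equal as DA is aperiodic.
-- Subwords are recognised by a J-trivial monoid, which also tells in which factor a
-- position lies; the values γ wᵢ₋₁ are computed in submonoids generated by B without
-- aᵢ, to which induction applies.
module Submission where

open import Defs

open import Algebra.Morphism.Structures using (module MonoidMorphisms)
import Algebra.Construct.Flip.Op as Flip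
import Algebra.Properties.Monoid.Mult as Mult
open import Algebra.Structures using (IsMonoid)
open import Data.Bool.Base using (if_then_else_)
open import Data.Empty using (⊥-elim)
open import Data.Fin.Base as Fin
  using (Fin; zero; suc; toℕ; punchIn; punchOut; funToFin; finToFun)
import Data.Fin.Properties as Fin
open import Data.Fin.Subset using (Subset; ∣_∣) renaming (_∈_ to _∈ˢ_)
open import Data.Fin.Subset.Properties using (p⊂q⇒∣p∣<∣q∣; ∣p∣≤n)
open import Data.List.Base
open import Data.List.Effectful.Foldable using (foldMap; ++-homo)
open import Data.List.Membership.Propositional using (_∈_)
open import Data.List.Membership.Propositional.Properties
  using (∈-lookup; ∈-allFin; ∈-filter⁺; ∈-filter⁻; ∈-cartesianProductWith⁺; ∈-cartesianProductWith⁻)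
open import Data.List.Properties
open import Data.List.Relation.Unary.All as All using (All; []; _∷_)
open import Data.List.Relation.Unary.AllPairs using ([]; _∷_)
open import Data.List.Relation.Unary.Any as Any using (here; there; index)
import Data.List.Relation.Unary.Any.Properties as Any
open import Data.List.Relation.Unary.Unique.Propositional using (Unique)
open import Data.List.Relation.Unary.Unique.Propositional.Properties using (filter⁺; allFin⁺)
open import Data.Nat.Base as ℕ using (ℕ; zero; suc; NonZero; z≤n; s≤s)
open import Data.Nat.Induction using (<-rec)
import Data.Nat.Properties as ℕ
open import Data.Product.Base using (∃; ∃₂; _×_; _,_; proj₁; proj₂; map₁; map₂)
open import Data.Product.Function.NonDependent.Propositional using (_×-↔_)
open import Data.Sum.Base using (_⊎_; inj₁; inj₂)
open import Data.Unit.Base using (⊤; tt)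
import Data.Vec.Base as Vec
import Data.Vec.Properties as Vec
open import Function.Base using (_∘_; case_of_; id)
open import Function.Bundles using (Inverse; Injection; _↔_)
open import Function.Properties.Inverse using (↔-refl; ↔-sym; ↔-trans; Inverse⇒Injection)
open import Level using (lift)
open import Relation.Binary.PropositionalEquality hiding (J)
open import Relation.Nullary using (¬_; Dec; yes; no; does; proof; Reflects; invert)
open import Relation.Nullary.Decidable using (map′; dec-true)

open FiniteMonoid using (Carrier)

private
  variable
    n k : ℕ
    A : Set

-- Finite quotients of free monoids.

lookup-injective : {xs : List A} → Unique xs → ∀ i j → lookup xs i ≡ lookup xs j → i ≡ j
lookup-injective (_ ∷ _)    zero    zero    _  = refl
lookup-injective (x≢ ∷ _)   zero    (suc j) eq = ⊥-elim (All.lookup x≢ (∈-lookup j) eq)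
lookup-injective (x≢ ∷ _)   (suc i) zero    eq = ⊥-elim (All.lookup x≢ (∈-lookup i) (sym eq))
lookup-injective (_ ∷ uniq) (suc i) (suc j) eq = cong suc (lookup-injective uniq i j eq)

words : ∀ n → ℕ → List (List (Fin n))
words n zero    = [] ∷ []
words n (suc k) = [] ∷ cartesianProductWith _∷_ (allFin n) (words n k)

∈-words : ∀ k (w : List (Fin n)) → length w ℕ.≤ k → w ∈ words n k
∈-words zero    []      _           = here refl
∈-words (suc k) []      _           = here refl
∈-words (suc k) (a ∷ w) (s≤s |w|≤k) =
  there (∈-cartesianProductWith⁺ _∷_ (∈-allFin a) (∈-words k w |w|≤k))

∈-words⁻ : ∀ k {w : List (Fin n)} → w ∈ words n k → length w ℕ.≤ k
∈-words⁻ zero    (here refl) = z≤n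
∈-words⁻ (suc k) (here refl) = z≤n
∈-words⁻ {n} (suc k) (there p)
  with _ , _ , _ , w∈ , refl ← ∈-cartesianProductWith⁻ _∷_ (allFin n) (words n k) p
  = s≤s (∈-words⁻ k w∈)

-- The quotient of (Fin n)* by the kernel of c, when that kernel is a congruence.
module Quotient {n K} (c : List (Fin n) → Fin K)
  (c-cong : ∀ u u′ v v′ → c u ≡ c u′ → c v ≡ c v′ → c (u ++ v) ≡ c (u′ ++ v′))
  where

  -- A word longer than K has two prefixes with the same value; cut out what lies between them.
  shorten : ∀ w → K ℕ.< length w → ∃ λ v → length v ℕ.< length w × c v ≡ c w
  shorten w K<|w|
    with i , j , i<j , eq ← Fin.pigeonhole (ℕ.n<1+n K) (λ (i : Fin (suc K)) → c (take (toℕ i) w))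
    = take (toℕ i) w ++ drop (toℕ j) w , shorter
    , trans (c-cong _ _ (drop (toℕ j) w) _ eq refl) (cong c (take++drop≡id (toℕ j) w))
    where
    j≤|w| : toℕ j ℕ.≤ length w
    j≤|w| = ℕ.≤-trans (ℕ.s≤s⁻¹ (Fin.toℕ<n j)) (ℕ.<⇒≤ K<|w|)

    open ℕ.≤-Reasoning
    shorter : length (take (toℕ i) w ++ drop (toℕ j) w) ℕ.< length w
    shorter = begin-strict
      length (take (toℕ i) w ++ drop (toℕ j) w)         ≡⟨ length-++ (take (toℕ i) w) ⟩
      length (take (toℕ i) w) ℕ.+ length (drop (toℕ j) w) ≡⟨ cong₂ ℕ._+_ (length-take (toℕ i) w) (length-drop (toℕ j) w) ⟩
      (toℕ i ℕ.⊓ length w) ℕ.+ (length w ℕ.∸ toℕ j)     ≤⟨ ℕ.+-monoˡ-≤ _ (ℕ.m⊓n≤m (toℕ i) _) ⟩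
      toℕ i ℕ.+ (length w ℕ.∸ toℕ j)                    <⟨ ℕ.+-monoˡ-< _ i<j ⟩
      toℕ j ℕ.+ (length w ℕ.∸ toℕ j)                    ≡⟨ ℕ.m+[n∸m]≡n j≤|w| ⟩
      length w                                          ∎

  short : ∀ w → ∃ λ v → length v ℕ.≤ K × c v ≡ c w
  short w = <-rec (λ l → ∀ w → length w ≡ l → ∃ λ v → length v ℕ.≤ K × c v ≡ c w) step _ w refl
    where
    step : ∀ l → (∀ {m} → m ℕ.< l → ∀ w → length w ≡ m → ∃ λ v → length v ℕ.≤ K × c v ≡ c w) →
           ∀ w → length w ≡ l → ∃ λ v → length v ℕ.≤ K × c v ≡ c w
    step _ rec w refl with length w ℕ.≤? K
    ... | yes |w|≤K = w , |w|≤K , refl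
    ... | no  |w|≰K with v , |v|<|w| , cv≡cw ← shorten w (ℕ.≰⇒> |w|≰K)
                    with u , |u|≤K , cu≡cv ← rec |v|<|w| v refl
                    = u , |u|≤K , trans cu≡cv cv≡cw

  -- By `short`, every value of `c` is attained on a word of length at most `K`, so a finite search
  -- decides attainment.
  image? : ∀ i → Dec (∃ λ w → c w ≡ i)
  image? i = map′ Any.satisfied to (Any.any? (λ w → c w Fin.≟ i) (words n K))
    where
    to : (∃ λ w → c w ≡ i) → Any.Any (λ w → c w ≡ i) (words n K)
    to (w , refl) with v , |v|≤K , cv≡cw ← short w
      = Any.map (λ { refl → cv≡cw }) (∈-words K v |v|≤K)

  abstract
    -- Keeping only attained codes makes `π` onto: each element has a representing word, and the
    -- monoid laws reduce to those of lists.
    values : List (Fin K)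
    values = filter image? (allFin K)

    value∈ : ∀ w → c w ∈ values
    value∈ w = ∈-filter⁺ image? (∈-allFin (c w)) (w , refl)

    π : List (Fin n) → Fin (length values)
    π w = index (value∈ w)

    lookup-π : ∀ w → lookup values (π w) ≡ c w
    lookup-π w = sym (Any.lookup-index (value∈ w))

    rep : Fin (length values) → List (Fin n)
    rep i = proj₁ (proj₂ (∈-filter⁻ image? {xs = allFin K} (∈-lookup i)))

    c-rep : ∀ i → c (rep i) ≡ lookup values i
    c-rep i = proj₂ (proj₂ (∈-filter⁻ image? {xs = allFin K} (∈-lookup i)))

    c-rep-π : ∀ w → c (rep (π w)) ≡ c w
    c-rep-π w = trans (c-rep (π w)) (lookup-π w)

    π-cong : ∀ {u v} → c u ≡ c v → π u ≡ π v
    π-cong {u} {v} eq = lookup-injective (filter⁺ image? (allFin⁺ K)) (π u) (π v)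
      (trans (lookup-π u) (trans eq (sym (lookup-π v))))

    π-rep : ∀ i → π (rep i) ≡ i
    π-rep i = lookup-injective (filter⁺ image? (allFin⁺ K)) _ _
      (trans (lookup-π (rep i)) (c-rep i))

  π-homo : ∀ u v → π (u ++ v) ≡ π (rep (π u) ++ rep (π v))
  π-homo u v = π-cong (sym (c-cong _ _ _ _ (c-rep-π u) (c-rep-π v)))

  quotient : FiniteMonoid
  quotient = record
    { Carrier  = Fin (length values)
    ; _∙_      = λ i j → π (rep i ++ rep j)
    ; ε        = π []
    ; isMonoid = record
      { isSemigroup = record
        { isMagma = record { isEquivalence = isEquivalence ; ∙-cong = cong₂ _ }
        ; assoc   = λ i j l → π-cong (trans (c-cong _ _ (rep l) _ (c-rep-π _) refl)
            (trans (cong c (++-assoc (rep i) (rep j) (rep l)))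
                   (c-cong (rep i) _ _ _ refl (sym (c-rep-π _)))))
        }
      ; identity = (λ i → trans (π-cong (c-cong _ _ (rep i) _ (c-rep-π []) refl)) (π-rep i))
                 , (λ i → trans (π-cong (trans (c-cong (rep i) _ _ _ refl (c-rep-π []))
                                               (cong c (++-identityʳ (rep i)))))
                                (π-rep i))
      }
    ; finite   = length values , ↔-refl
    }

-- Products and opposites of finite monoids; closure of `V` under products.

mkHom : ∀ (M : FiniteMonoid) {f : List A → Carrier M} →
        f [] ≡ FiniteMonoid.ε M → (∀ u v → f (u ++ v) ≡ FiniteMonoid._∙_ M (f u) (f v)) → IsHom M f
mkHom M {f} f-ε f-∙ = record
  { isMagmaHomomorphism = record
    { isRelHomomorphism = record { cong = cong f } ; homo = f-∙ }
  ; ε-homo = f-ε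
  }

infixr 7 _×ᴹ_
_×ᴹ_ : FiniteMonoid → FiniteMonoid → FiniteMonoid
M ×ᴹ N = record
  { Carrier  = M.Carrier × N.Carrier
  ; _∙_      = λ (x , y) (x′ , y′) → x M.∙ x′ , y N.∙ y′
  ; ε        = M.ε , N.ε
  ; isMonoid = record
    { isSemigroup = record
      { isMagma = record { isEquivalence = isEquivalence ; ∙-cong = cong₂ _ }
      ; assoc   = λ _ _ _ → cong₂ _,_ (Mᵐ.assoc _ _ _) (Nᵐ.assoc _ _ _)
      }
    ; identity = (λ _ → cong₂ _,_ (Mᵐ.identityˡ _) (Nᵐ.identityˡ _))
               , (λ _ → cong₂ _,_ (Mᵐ.identityʳ _) (Nᵐ.identityʳ _))
    }
  ; finite   = proj₁ M.finite ℕ.* proj₁ N.finite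
             , ↔-trans (proj₂ M.finite ×-↔ proj₂ N.finite) (↔-sym Fin.*↔×)
  }
  where
  module M = FiniteMonoid M
  module N = FiniteMonoid N
  module Mᵐ = IsMonoid M.isMonoid
  module Nᵐ = IsMonoid N.isMonoid

op : FiniteMonoid → FiniteMonoid
op M = record
  { Carrier  = Carrier M
  ; _∙_      = λ x y → y ∙ x
  ; ε        = ε
  ; isMonoid = Flip.isMonoid isMonoid
  ; finite   = finite
  }
  where open FiniteMonoid M

trivial : FiniteMonoid
trivial = record
  { Carrier  = ⊤
  ; _∙_      = λ _ _ → tt
  ; ε        = tt
  ; isMonoid = record
    { isSemigroup = record
      { isMagma = record { isEquivalence = isEquivalence ; ∙-cong = λ _ _ → refl }
      ; assoc   = λ _ _ _ → refl
      }
    ; identity = (λ _ → refl) , (λ _ → refl)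
    }
  ; finite   = 1 , ↔-sym Fin.1↔⊤
  }

↔-injective : ∀ {A B : Set} (i : A ↔ B) {x y} → Inverse.to i x ≡ Inverse.to i y → x ≡ y
↔-injective i = Injection.injective (Inverse⇒Injection i)

ideal-refl : ∀ M x → FiniteMonoid.ideal M x x
ideal-refl M x = ε , ε , sym (trans (identityʳ (ε ∙ x)) (identityˡ x))
  where
  open FiniteMonoid M
  open IsMonoid isMonoid using (identityˡ; identityʳ)

J-× : ∀ M N → J M → J N → J (M ×ᴹ N)
J-× M N JM JN (s , s′) (t , t′) (s≤t , t≤s) = cong₂ _,_
  (JM s t (restrict₁ s≤t , restrict₁ t≤s))
  (JN s′ t′ (restrict₂ s≤t , restrict₂ t≤s))
  where
  module M = FiniteMonoid M
  module N = FiniteMonoid N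
  restrict₁ : ∀ {x x′ y y′} → (∀ {z} → FiniteMonoid.ideal (M ×ᴹ N) (x , x′) z → FiniteMonoid.ideal (M ×ᴹ N) (y , y′) z) →
              ∀ {z} → M.ideal x z → M.ideal y z
  restrict₁ sub (u , v , refl) with (u′ , _) , (v′ , _) , eq ← sub ((u , N.ε) , (v , N.ε) , refl)
    = u′ , v′ , cong proj₁ eq
  restrict₂ : ∀ {x x′ y y′} → (∀ {z} → FiniteMonoid.ideal (M ×ᴹ N) (x , x′) z → FiniteMonoid.ideal (M ×ᴹ N) (y , y′) z) →
              ∀ {z} → N.ideal x′ z → N.ideal y′ z
  restrict₂ sub (u , v , refl) with (_ , u′) , (_ , v′) , eq ← sub ((M.ε , u) , (M.ε , v) , refl)
    = u′ , v′ , cong proj₂ eq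

J-op : ∀ M → J M → J (op M)
J-op M JM s t (s≤t , t≤s) = JM s t (flip-ideal s≤t , flip-ideal t≤s)
  where
  open FiniteMonoid M
  open IsMonoid isMonoid using (assoc)
  flip-ideal : ∀ {x y} → (∀ {z} → FiniteMonoid.ideal (op M) x z → FiniteMonoid.ideal (op M) y z) →
               ∀ {z} → ideal x z → ideal y z
  flip-ideal sub (u , v , refl) with u′ , v′ , eq ← sub (v , u , assoc u _ v)
    = v′ , u′ , trans eq (sym (assoc v′ _ u′))

module Hom {A : Set} (M : FiniteMonoid) {f : List A → Carrier M} (f-hom : IsHom {A} M f) where
  open FiniteMonoid M using (_∙_; ε)
  private
    module f = MonoidMorphisms.IsMonoidHomomorphism f-hom

  homo : ∀ u v → f (u ++ v) ≡ f u ∙ f v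
  homo = f.homo

  ε-homo : f [] ≡ ε
  ε-homo = f.ε-homo

map-τ : ∀ {N N′ : Set} (ψ : List A → N) (r : N → N′) w →
        map (map₁ r ∘ map₂ (map₂ r)) (τ ψ w) ≡ τ (r ∘ ψ) w
map-τ ψ r w = map-tabulate _ _

pair-hom : ∀ M N {f : List A → Carrier M} {g : List A → Carrier N} →
           IsHom M f → IsHom N g → IsHom (M ×ᴹ N) (λ w → f w , g w)
pair-hom M N f-hom g-hom = mkHom (M ×ᴹ N)
  (cong₂ _,_ (Hom.ε-homo M f-hom) (Hom.ε-homo N g-hom))
  (λ u v → cong₂ _,_ (Hom.homo M f-hom u v) (Hom.homo N g-hom u v))

map-hom : ∀ {A B : Set} M {h : List B → Carrier M} → IsHom M h → (r : A → B) → IsHom M (h ∘ map r)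
map-hom M {h} h-hom r = mkHom M (Hom.ε-homo M h-hom)
  (λ u v → trans (cong h (map-++ r u v)) (Hom.homo M h-hom _ _))

-- The products of the two `N`s and of the two `K`s are the witnesses. Each context letter is
-- projected to one factor before `h₁` or `h₂` reads it; `map-τ` shows that this recovers `τ ψ₁` and
-- `τ ψ₂`.
V-× : ∀ n M N → V (suc n) M → V (suc n) N → V (suc n) (M ×ᴹ N)
V-× zero    M N (lift JM) (lift JN) = lift (J-× M N JM JN)
V-× (suc n) M N VM VN A A-fin φ φ-hom φ-surj
  with N₁ , JN₁ , ψ₁ , ψ₁-hom , K₁ , VK₁ , h₁ , h₁-hom , sep₁
       ← VM A A-fin (proj₁ ∘ φ)
           (mkHom M (cong proj₁ (Hom.ε-homo (M ×ᴹ N) φ-hom)) (λ u v → cong proj₁ (Hom.homo (M ×ᴹ N) φ-hom u v)))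
           (λ y → let w , eq = φ-surj (y , FiniteMonoid.ε N) in w , λ z → cong proj₁ (eq z))
     | N₂ , JN₂ , ψ₂ , ψ₂-hom , K₂ , VK₂ , h₂ , h₂-hom , sep₂
       ← VN A A-fin (proj₂ ∘ φ)
           (mkHom N (cong proj₂ (Hom.ε-homo (M ×ᴹ N) φ-hom)) (λ u v → cong proj₂ (Hom.homo (M ×ᴹ N) φ-hom u v)))
           (λ y → let w , eq = φ-surj (FiniteMonoid.ε M , y) in w , λ z → cong proj₂ (eq z))
  = N₁ ×ᴹ N₂ , J-× N₁ N₂ JN₁ JN₂
  , (λ w → ψ₁ w , ψ₂ w) , pair-hom N₁ N₂ ψ₁-hom ψ₂-hom
  , K₁ ×ᴹ K₂ , V-× n K₁ K₂ VK₁ VK₂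
  , (λ x → h₁ (map _ x) , h₂ (map _ x))
  , pair-hom K₁ K₂ (map-hom K₁ h₁-hom _) (map-hom K₂ h₂-hom _)
  , λ v w ψ-eq h-eq → cong₂ _,_
      (sep₁ v w (cong proj₁ ψ-eq)
        (subst₂ (λ x y → h₁ x ≡ h₁ y) (map-τ ψ proj₁ v) (map-τ ψ proj₁ w) (cong proj₁ h-eq)))
      (sep₂ v w (cong proj₂ ψ-eq)
        (subst₂ (λ x y → h₂ x ≡ h₂ y) (map-τ ψ proj₂ v) (map-τ ψ proj₂ w) (cong proj₂ h-eq)))
  where
  ψ : List A → Carrier N₁ × Carrier N₂
  ψ w = ψ₁ w , ψ₂ w

J-trivial : J trivial
J-trivial tt tt _ = refl

V-trivial : ∀ n → V (suc n) trivial
V-trivial zero              = lift J-trivial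
V-trivial (suc n) A _ _ _ _ =
    trivial , J-trivial , (λ _ → tt) , mkHom trivial refl (λ _ _ → refl)
  , trivial , V-trivial n , (λ _ → tt) , mkHom trivial refl (λ _ _ → refl)
  , λ _ _ _ _ → refl

-- Omega powers and Green's relations in DA.

module DATheory (M : FiniteMonoid) where
  open FiniteMonoid M
  open IsMonoid isMonoid using (assoc; identityˡ; identityʳ)
  open Mult monoid using (×-homo-+)
  open ≡-Reasoning

  omega : ∀ m → ∃ λ e → e IsOmegaPowerOf m
  omega m with size , fin ← finite
          with i , j , i<j , eq ← Fin.pigeonhole (ℕ.n<1+n size) (λ (i : Fin (suc size)) → Inverse.to fin (m ^ toℕ i))
    = m ^ r , idem , ℕ.pred r , cong (m ^_) (sym (ℕ.suc-pred r))
    where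
    p = toℕ j ℕ.∸ toℕ i
    -- A multiple of the period `p` that is at least `toℕ i`, so `m ^ r` lies on the cycle of powers
    -- and is idempotent. The successor keeps `r` positive when `i` is `zero`.
    r = suc (toℕ i) ℕ.* p
    instance
      p≢0 : NonZero p
      p≢0 = ℕ.>-nonZero (ℕ.m<n⇒0<n∸m i<j)
      r≢0 : NonZero r
      r≢0 = ℕ.m*n≢0 (suc (toℕ i)) p

    i≤r : toℕ i ℕ.≤ r
    i≤r = ℕ.≤-trans (ℕ.n≤1+n (toℕ i)) (ℕ.m≤m*n (suc (toℕ i)) p)

    mⁱ≡mʲ : m ^ toℕ i ≡ m ^ (toℕ i ℕ.+ p)
    mⁱ≡mʲ = begin
      m ^ toℕ i           ≡⟨ ↔-injective fin eq ⟩
      m ^ toℕ j           ≡⟨ cong (m ^_) (ℕ.m+[n∸m]≡n (ℕ.<⇒≤ i<j)) ⟨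
      m ^ (toℕ i ℕ.+ p)   ∎

    period : ∀ l → m ^ (toℕ i) ≡ m ^ (toℕ i ℕ.+ l ℕ.* p)
    period zero    = cong (m ^_) (sym (ℕ.+-identityʳ (toℕ i)))
    period (suc l) = begin
      m ^ toℕ i                         ≡⟨ period l ⟩
      m ^ (toℕ i ℕ.+ l ℕ.* p)           ≡⟨ ×-homo-+ m (toℕ i) (l ℕ.* p) ⟩
      m ^ toℕ i ∙ m ^ (l ℕ.* p)         ≡⟨ cong (_∙ m ^ (l ℕ.* p)) mⁱ≡mʲ ⟩
      m ^ (toℕ i ℕ.+ p) ∙ m ^ (l ℕ.* p) ≡⟨ ×-homo-+ m (toℕ i ℕ.+ p) (l ℕ.* p) ⟨
      m ^ (toℕ i ℕ.+ p ℕ.+ l ℕ.* p)     ≡⟨ cong (m ^_) (ℕ.+-assoc (toℕ i) p (l ℕ.* p)) ⟩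
      m ^ (toℕ i ℕ.+ suc l ℕ.* p)       ∎

    idem : m ^ r ∙ m ^ r ≡ m ^ r
    idem = begin
      m ^ r ∙ m ^ r                              ≡⟨ ×-homo-+ m r r ⟨
      m ^ (r ℕ.+ r)                              ≡⟨ cong (λ s → m ^ (s ℕ.+ r)) (ℕ.m∸n+n≡m i≤r) ⟨
      m ^ (r ℕ.∸ toℕ i ℕ.+ toℕ i ℕ.+ r)          ≡⟨ cong (m ^_) (ℕ.+-assoc (r ℕ.∸ toℕ i) (toℕ i) r) ⟩
      m ^ (r ℕ.∸ toℕ i ℕ.+ (toℕ i ℕ.+ r))        ≡⟨ ×-homo-+ m (r ℕ.∸ toℕ i) (toℕ i ℕ.+ r) ⟩
      m ^ (r ℕ.∸ toℕ i) ∙ m ^ (toℕ i ℕ.+ r)      ≡⟨ cong (m ^ (r ℕ.∸ toℕ i) ∙_) (period (suc (toℕ i))) ⟨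
      m ^ (r ℕ.∸ toℕ i) ∙ m ^ toℕ i              ≡⟨ ×-homo-+ m (r ℕ.∸ toℕ i) (toℕ i) ⟨
      m ^ (r ℕ.∸ toℕ i ℕ.+ toℕ i)                ≡⟨ cong (m ^_) (ℕ.m∸n+n≡m i≤r) ⟩
      m ^ r                                      ∎

  ^-fixʳ : ∀ {u m} → u ∙ m ≡ u → ∀ k → u ∙ m ^ k ≡ u
  ^-fixʳ fix zero    = identityʳ _
  ^-fixʳ {u} {m} fix (suc k) = trans (sym (assoc u m (m ^ k))) (trans (cong (_∙ m ^ k) fix) (^-fixʳ fix k))

  ^-fixˡ : ∀ {u m} → m ∙ u ≡ u → ∀ k → m ^ k ∙ u ≡ u
  ^-fixˡ fix zero    = identityˡ _
  ^-fixˡ {u} {m} fix (suc k) = trans (assoc m (m ^ k) u) (trans (cong (m ∙_) (^-fixˡ fix k)) fix)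

  -- The form in which DA enters the factorization: a factor `b` of a right stabiliser of `u` keeps
  -- `u` in its R-class. It is supplied both for `M` and for `op M`.
  RStable : Set
  RStable = ∀ u x b y → u ∙ (x ∙ b ∙ y) ≡ u → ∃ λ z → u ∙ b ∙ z ≡ u

  -- For `e` the omega power of the stabiliser, `u e = u` and `e b e = e`, so `e` itself leads back
  -- from `u b` to `u`.
  DA⇒RStable : DA M → RStable
  DA⇒RStable da u x b y fix with e , isω@(_ , l , refl) ← omega (x ∙ b ∙ y) = e , (begin
    u ∙ b ∙ e         ≡⟨ cong (λ t → t ∙ b ∙ e) ue≡u ⟨
    u ∙ e ∙ b ∙ e     ≡⟨ cong (_∙ e) (assoc u e b) ⟩
    u ∙ (e ∙ b) ∙ e   ≡⟨ assoc u (e ∙ b) e ⟩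
    u ∙ (e ∙ b ∙ e)   ≡⟨ cong (u ∙_) (da x b y e isω) ⟩
    u ∙ e             ≡⟨ ue≡u ⟩
    u                 ∎)
    where
    ue≡u : u ∙ e ≡ u
    ue≡u = ^-fixʳ fix (suc l)

  DA⇒LStable : DA M → ∀ u x b y → (x ∙ b ∙ y) ∙ u ≡ u → ∃ λ z → z ∙ (b ∙ u) ≡ u
  DA⇒LStable da u x b y fix with e , isω@(_ , l , refl) ← omega (x ∙ b ∙ y) = e , (begin
    e ∙ (b ∙ u)         ≡⟨ cong (λ t → e ∙ (b ∙ t)) eu≡u ⟨
    e ∙ (b ∙ (e ∙ u))   ≡⟨ cong (e ∙_) (assoc b e u) ⟨
    e ∙ (b ∙ e ∙ u)     ≡⟨ assoc e (b ∙ e) u ⟨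
    e ∙ (b ∙ e) ∙ u     ≡⟨ cong (_∙ u) (assoc e b e) ⟨
    e ∙ b ∙ e ∙ u       ≡⟨ cong (_∙ u) (da x b y e isω) ⟩
    e ∙ u               ≡⟨ eu≡u ⟩
    u                   ∎)
    where
    eu≡u : e ∙ u ≡ u
    eu≡u = ^-fixˡ fix (suc l)

  -- With e = (z z′)^ω: y e = y, hence x e = x, whereas x e = y e z e = y e = y.
  DA⇒H-trivial : DA M → ∀ {x y u z z′} → x ≡ y ∙ z → y ≡ x ∙ z′ → x ≡ u ∙ y → x ≡ y
  DA⇒H-trivial da {x} {y} {u} {z} {z′} x≡yz y≡xz′ x≡uy
    with e , ee≡e , l , e≡ ← omega (ε ∙ z ∙ z′) = begin
    x                 ≡⟨ x≡uy ⟩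
    u ∙ y             ≡⟨ cong (u ∙_) ye≡y ⟨
    u ∙ (y ∙ e)       ≡⟨ assoc u y e ⟨
    u ∙ y ∙ e         ≡⟨ cong (_∙ e) x≡uy ⟨
    x ∙ e             ≡⟨ cong (_∙ e) x≡yz ⟩
    y ∙ z ∙ e         ≡⟨ cong (λ t → t ∙ z ∙ e) ye≡y ⟨
    y ∙ e ∙ z ∙ e     ≡⟨ cong (_∙ e) (assoc y e z) ⟩
    y ∙ (e ∙ z) ∙ e   ≡⟨ assoc y (e ∙ z) e ⟩
    y ∙ (e ∙ z ∙ e)   ≡⟨ cong (y ∙_) (da ε z z′ e (ee≡e , l , e≡)) ⟩
    y ∙ e             ≡⟨ ye≡y ⟩
    y                 ∎
    where
    ye≡y : y ∙ e ≡ y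
    ye≡y = trans (cong (y ∙_) e≡) (^-fixʳ (begin
      y ∙ (ε ∙ z ∙ z′)  ≡⟨ cong (λ t → y ∙ (t ∙ z′)) (identityˡ z) ⟩
      y ∙ (z ∙ z′)      ≡⟨ assoc y z z′ ⟨
      y ∙ z ∙ z′        ≡⟨ cong (_∙ z′) x≡yz ⟨
      x ∙ z′            ≡⟨ y≡xz′ ⟨
      y                 ∎) (suc l))

-- Greedy subword matching and segments.

strike : List (Fin n) → Fin n → List (Fin n)
strike []      b = []
strike (a ∷ q) b = if does (a Fin.≟ b) then q else a ∷ q

-- q • w is what remains of q after greedily matching it, as a subword, against w.
infixl 6 _•_
_•_ : List (Fin n) → List (Fin n) → List (Fin n)
_•_ = foldl strike

-- For q = p ∷ʳ a, seg a q w is the factor of w strictly between the end of the leftmost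
-- occurrence of p as a subword and the next a, as a word over the alphabet without a.
keep : Fin (suc n) → List (Fin (suc n)) → Fin (suc n) → List (Fin n)
keep a q b with a Fin.≟ b | ≡-dec Fin._≟_ q (a ∷ [])
... | no a≢b | yes _ = punchOut a≢b ∷ []
... | _      | _     = []

seg : Fin (suc n) → List (Fin (suc n)) → List (Fin (suc n)) → List (Fin n)
seg a q []      = []
seg a q (b ∷ w) = keep a q b ++ seg a (strike q b) w

•-++ : ∀ (q u v : List (Fin n)) → q • (u ++ v) ≡ q • u • v
•-++ q u v = foldl-++ strike q u v

seg-++ : ∀ a (q u v : List (Fin (suc n))) → seg a q (u ++ v) ≡ seg a q u ++ seg a (q • u) v
seg-++ a q []      v = refl
seg-++ a q (b ∷ u) v = trans (cong (keep a q b ++_) (seg-++ a (strike q b) u v))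
                             (sym (++-assoc (keep a q b) _ _))

-- The mirror image of `seg`. Reversing the result lets its value be taken in `M`, so the same
-- submonoids serve both sides.
rseg : Fin (suc n) → List (Fin (suc n)) → List (Fin (suc n)) → List (Fin n)
rseg a q w = reverse (seg a q (reverse w))

rseg-++ : ∀ a (q u v : List (Fin (suc n))) → rseg a q (u ++ v) ≡ rseg a (q • reverse v) u ++ rseg a q v
rseg-++ a q u v = begin
  reverse (seg a q (reverse (u ++ v)))                                      ≡⟨ cong (reverse ∘ seg a q) (reverse-++ u v) ⟩
  reverse (seg a q (reverse v ++ reverse u))                                ≡⟨ cong reverse (seg-++ a q (reverse v) (reverse u)) ⟩
  reverse (seg a q (reverse v) ++ seg a (q • reverse v) (reverse u))        ≡⟨ reverse-++ (seg a q (reverse v)) _ ⟩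
  rseg a (q • reverse v) u ++ rseg a q v                                    ∎
  where open ≡-Reasoning

keep-≡ : ∀ (a : Fin (suc n)) q → keep a q a ≡ []
keep-≡ a q with a Fin.≟ a | ≡-dec Fin._≟_ q (a ∷ [])
... | no a≢a | _ = ⊥-elim (a≢a refl)
... | yes _  | _ = refl

keep-≢ : ∀ {a : Fin (suc n)} {q} b → q ≢ a ∷ [] → keep a q b ≡ []
keep-≢ {a = a} {q} b q≢a with a Fin.≟ b | ≡-dec Fin._≟_ q (a ∷ [])
... | no _  | yes q≡a = ⊥-elim (q≢a q≡a)
... | no _  | no _    = refl
... | yes _ | _       = refl

keep-in : ∀ {a b : Fin (suc n)} → a ≢ b → map (punchIn a) (keep a (a ∷ []) b) ≡ b ∷ []
keep-in {a = a} {b} a≢b with a Fin.≟ b | ≡-dec Fin._≟_ (a ∷ []) (a ∷ [])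
... | yes a≡b | _       = ⊥-elim (a≢b a≡b)
... | no a≢b′ | yes _   = cong (_∷ []) (Fin.punchIn-punchOut a≢b′)
... | no _    | no a≢a  = ⊥-elim (a≢a refl)

strike-≡ : ∀ (a : Fin n) q → strike (a ∷ q) a ≡ q
strike-≡ a q with a Fin.≟ a
... | yes _  = refl
... | no a≢a = ⊥-elim (a≢a refl)

strike-≢ : ∀ {a b : Fin n} {q} → a ≢ b → strike (a ∷ q) b ≡ a ∷ q
strike-≢ {a = a} {b} a≢b with a Fin.≟ b
... | yes a≡b = ⊥-elim (a≢b a≡b)
... | no _    = refl

seg-[] : ∀ (a : Fin (suc n)) w → seg a [] w ≡ []
seg-[] a []      = refl
seg-[] a (b ∷ w) = cong₂ _++_ (keep-≢ {a = a} b λ ()) (seg-[] a w)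

seg-before : ∀ {a : Fin (suc n)} {u} v → All (a ≢_) u →
             map (punchIn a) (seg a (a ∷ []) (u ++ a ∷ v)) ≡ u
seg-before {a = a} v [] rewrite keep-≡ a (a ∷ []) | strike-≡ a [] | seg-[] a v = refl
seg-before {a = a} {b ∷ u} v (a≢b ∷ a∉u) rewrite strike-≢ {q = []} a≢b = begin
  map (punchIn a) (keep a (a ∷ []) b ++ seg a (a ∷ []) (u ++ a ∷ v))
    ≡⟨ map-++ (punchIn a) (keep a (a ∷ []) b) _ ⟩
  map (punchIn a) (keep a (a ∷ []) b) ++ map (punchIn a) (seg a (a ∷ []) (u ++ a ∷ v))
    ≡⟨ cong₂ _++_ (keep-in a≢b) (seg-before v a∉u) ⟩
  b ∷ u ∎
  where open ≡-Reasoning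

•-first : ∀ {a : Fin n} q {u} v → All (a ≢_) u → (a ∷ q) • (u ++ a ∷ v) ≡ q • v
•-first {a = a} q v []            rewrite strike-≡ a q = refl
•-first {a = a} q v (a≢b ∷ a∉u)  rewrite strike-≢ {q = q} a≢b = •-first q v a∉u

•-absent : ∀ {a : Fin n} q {u} → All (a ≢_) u → (a ∷ q) • u ≡ a ∷ q
•-absent q []           = refl
•-absent q (a≢b ∷ a∉u) rewrite strike-≢ {q = q} a≢b = •-absent q a∉u

-- Until `a` is met the pattern has at least two letters, so nothing is kept. The second letter `c`
-- matters: for the pattern `a ∷ []` and `b` equal to `a`, the letters of `u` would be kept.
seg-after : ∀ {a : Fin (suc n)} b c q {u} v → All (a ≢_) u →
            seg b (a ∷ c ∷ q) (u ++ a ∷ v) ≡ seg b (c ∷ q) v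
seg-after {a = a} b c q v []
  rewrite keep-≢ {a = b} {a ∷ c ∷ q} a (λ ()) | strike-≡ a (c ∷ q) = refl
seg-after {a = a} b c q {d ∷ _} v (a≢d ∷ a∉u)
  rewrite keep-≢ {a = b} {a ∷ c ∷ q} d (λ ()) | strike-≢ {q = c ∷ q} a≢d = seg-after b c q v a∉u

firstOccurrence : ∀ (a : Fin n) w →
  All (a ≢_) w ⊎ ∃₂ λ u v → w ≡ u ++ a ∷ v × All (a ≢_) u
firstOccurrence a [] = inj₁ []
firstOccurrence a (b ∷ w) with a Fin.≟ b
... | yes refl = inj₂ ([] , w , refl , [])
... | no a≢b with firstOccurrence a w
... | inj₁ a∉w                      = inj₁ (a≢b ∷ a∉w)
... | inj₂ (u , v , refl , a∉u)     = inj₂ (b ∷ u , v , refl , a≢b ∷ a∉u)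

-- Factorization of a word at the falls of the R-class.

module Factorization (M : FiniteMonoid) (g : Fin (suc n) → Carrier M)
  (stable : DATheory.RStable M) where

  open FiniteMonoid M hiding (Carrier)
  open IsMonoid isMonoid using (assoc; identityʳ)
  open ≡-Reasoning

  γ : List (Fin (suc n)) → Carrier M
  γ = foldMap rawMonoid g

  γ-++ : ∀ u v → γ (u ++ v) ≡ γ u ∙ γ v
  γ-++ u v = ++-homo monoid g u

  γ∖ : (a : Fin (suc n)) → List (Fin n) → Carrier M
  γ∖ a = γ ∘ map (punchIn a)

  size : ℕ
  size = proj₁ finite

  open Inverse (proj₂ finite) using (to; from; strictlyInverseʳ)

  infix 4 _≼_ _≼?_
  -- Green's R-preorder, reversed: multiplying on the right goes up.
  _≼_ : Carrier M → Carrier M → Set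
  x ≼ y = ∃ λ z → x ∙ z ≡ y

  _≼?_ : ∀ x y → Dec (x ≼ y)
  x ≼? y = map′
    (λ (i , eq) → from i , ↔-injective (proj₂ finite) eq)
    (λ (z , eq) → to z , cong to (trans (cong (x ∙_) (strictlyInverseʳ z)) eq))
    (Fin.any? λ i → to (x ∙ from i) Fin.≟ to y)

  ≼-trans : ∀ {x y z} → x ≼ y → y ≼ z → x ≼ z
  ≼-trans {x} (u , refl) (v , refl) = u ∙ v , sym (assoc x u v)

  rightIdeal : Carrier M → Subset size
  rightIdeal x = Vec.tabulate λ i → does (x ≼? from i)

  -- The size of the right ideal `x M`. It drops at each fall and is at most `size`, which bounds
  -- the number of falls.
  rank : Carrier M → ℕ
  rank x = ∣ rightIdeal x ∣

  ∈-rightIdeal⁺ : ∀ {x} i → x ≼ from i → i ∈ˢ rightIdeal x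
  ∈-rightIdeal⁺ {x} i x≼ = Vec.lookup⇒[]= i _
    (trans (Vec.lookup∘tabulate _ i) (dec-true (x ≼? from i) x≼))

  ∈-rightIdeal⁻ : ∀ {x} i → i ∈ˢ rightIdeal x → x ≼ from i
  ∈-rightIdeal⁻ {x} i i∈ = invert (subst (Reflects (x ≼ from i))
    (trans (sym (Vec.lookup∘tabulate _ i)) (Vec.[]=⇒lookup i∈)) (proof (x ≼? from i)))

  -- The ideal of `y` lies in that of `x` by transitivity, and it misses `x` itself.
  rank-< : ∀ {x y} → x ≼ y → ¬ (y ≼ x) → rank y ℕ.< rank x
  rank-< {x} {y} x≼y y⋠x = p⊂q⇒∣p∣<∣q∣
    ( (λ {i} i∈ → ∈-rightIdeal⁺ i (≼-trans x≼y (∈-rightIdeal⁻ i i∈)))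
    , to x
    , ∈-rightIdeal⁺ (to x) (subst (x ≼_) (sym (strictlyInverseʳ x)) (ε , identityʳ x))
    , λ x∈ → y⋠x (subst (y ≼_) (strictlyInverseʳ x) (∈-rightIdeal⁻ (to x) x∈)))

  -- If c is R-equivalent to m: the first letter of w at which c ∙ γ w leaves this R-class.
  data Fall (m c : Carrier M) : List (Fin (suc n)) → Set where
    stays : ∀ {w} → c ∙ γ w ≼ m → Fall m c w
    falls : ∀ u a v → c ∙ γ u ≼ m → ¬ (c ∙ γ u ∙ g a ≼ m) → Fall m c (u ++ a ∷ v)

  fall : ∀ m c w → c ≼ m → Fall m c w
  fall m c []      c≼m = stays (subst (_≼ m) (sym (identityʳ c)) c≼m)
  fall m c (a ∷ w) c≼m with c ∙ g a ≼? m
  ... | no  ca⋠m = falls [] a w (subst (_≼ m) (sym (identityʳ c)) c≼m)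
                     (ca⋠m ∘ subst (λ x → x ∙ g a ≼ m) (identityʳ c))
  ... | yes ca≼m with fall m (c ∙ g a) w ca≼m
  ... | stays h         = stays (subst (_≼ m) (assoc c (g a) (γ w)) h)
  ... | falls u b v h h′ = falls (a ∷ u) b v (subst (_≼ m) (assoc c (g a) (γ u)) h)
                            (h′ ∘ subst (λ x → x ∙ g b ≼ m) (sym (assoc c (g a) (γ u))))

  -- Suppose `a` occurs in the word, and let `x` be the value after it. As `z` leads from `x` back
  -- to `m`, rereading the word fixes `x`. This stabiliser has the factor `g a`, so by `stable`
  -- reading `a` at `x` would not be a fall.
  absent-before-fall : ∀ {m} a u → m ∙ γ u ≼ m → ¬ (m ∙ γ u ∙ g a ≼ m) → All (a ≢_) u
  absent-before-fall {m} a w (z , mwz≡m) mwa⋠m with firstOccurrence a w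
  ... | inj₁ a∉w = a∉w
  ... | inj₂ (u , v , refl , _) = ⊥-elim (mwa⋠m (≼-trans (stable x (z ∙ γ u) (g a) (γ v) fix) (z , mwz≡m)))
    where
    x = m ∙ γ (u ++ a ∷ v)
    fix : x ∙ (z ∙ γ u ∙ g a ∙ γ v) ≡ x
    fix = begin
      x ∙ (z ∙ γ u ∙ g a ∙ γ v)     ≡⟨ cong (x ∙_) (assoc (z ∙ γ u) (g a) (γ v)) ⟩
      x ∙ (z ∙ γ u ∙ (g a ∙ γ v))   ≡⟨ cong (x ∙_) (assoc z (γ u) (g a ∙ γ v)) ⟩
      x ∙ (z ∙ (γ u ∙ γ (a ∷ v)))   ≡⟨ assoc x z _ ⟨
      x ∙ z ∙ (γ u ∙ γ (a ∷ v))     ≡⟨ cong₂ _∙_ mwz≡m (sym (γ-++ u (a ∷ v))) ⟩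
      x                             ∎

  -- Agreement on subwords is stated through remainders: `q • w` is empty exactly when `q` is a
  -- subword of `w`, and remainders compose along concatenation.
  record Similar (k : ℕ) (w v : List (Fin (suc n))) : Set where
    field
      rest    : ∀ q → length q ℕ.≤ k → q • w ≡ q • v
      segment : ∀ a q → length q ℕ.≤ k → γ∖ a (seg a q w) ≡ γ∖ a (seg a q v)

  -- Here `m` is the value of the prefix already read. Induction on `k`, which bounds both the rank
  -- of `m` and the length of patterns: a fall lowers the rank, and its letter is put in front of
  -- every pattern used for the tails.
  ≼-from : ∀ k m {w v} → rank m ℕ.≤ k → Similar k w v → m ∙ γ w ≼ m ∙ γ v
  ≼-from k m {w} {v} rank≤k w∼v with fall m m w (ε , identityʳ m)
  -- The whole of `w` stays in the R-class of `m`, and `m ∙ γ v` is a right multiple of `m`.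
  ... | stays mw≼m = ≼-trans mw≼m (γ v , refl)
  ≼-from zero m rank≤k w∼v | falls u a w′ mu≼m mua⋠m =
    ⊥-elim (ℕ.n≮0 (ℕ.<-≤-trans (rank-< (γ u ∙ g a , sym (assoc m (γ u) (g a))) mua⋠m) rank≤k))
  ≼-from (suc k) m {v = v} rank≤k w∼v | falls u a w′ mu≼m mua⋠m
    with a∉u ← absent-before-fall a u mu≼m mua⋠m
    with firstOccurrence a v
  -- The pattern `a ∷ []` is used up by the word with the fall but untouched by `v`.
  ... | inj₁ a∉v = case trans (sym (•-first [] w′ a∉u)) (trans (rest (a ∷ []) (s≤s z≤n)) (•-absent [] a∉v))
                    of λ eq → ⊥-elim (absurd w′ eq)
    where
    open Similar w∼v
    absurd : ∀ w′ → [] • w′ ≢ a ∷ []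
    absurd (_ ∷ w′) = absurd w′
  -- Both words are cut at their first `a`. The pattern `a ∷ []` gives the factors before it the
  -- same value, so one `m′` continues on both sides.
  ... | inj₂ (x , v′ , refl , a∉x) = subst₂ _≼_ (split u w′ refl) (split x v′ γx≡γu)
          (≼-from k m′ {w′} {v′} rank≤k′ record { rest = rest′ ; segment = segment′ })
    where
    open Similar w∼v
    m′ = m ∙ γ u ∙ g a

    rank≤k′ : rank m′ ℕ.≤ k
    rank≤k′ = ℕ.s≤s⁻¹ (ℕ.<-≤-trans (rank-< (γ u ∙ g a , sym (assoc m (γ u) (g a))) mua⋠m) rank≤k)

    γx≡γu : γ x ≡ γ u
    γx≡γu = begin
      γ x                                         ≡⟨ cong γ (seg-before v′ a∉x) ⟨
      γ∖ a (seg a (a ∷ []) (x ++ a ∷ v′))         ≡⟨ segment a (a ∷ []) (s≤s z≤n) ⟨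
      γ∖ a (seg a (a ∷ []) (u ++ a ∷ w′))         ≡⟨ cong γ (seg-before w′ a∉u) ⟩
      γ u                                         ∎

    split : ∀ y t → γ y ≡ γ u → m′ ∙ γ t ≡ m ∙ γ (y ++ a ∷ t)
    split y t γy≡γu = begin
      m ∙ γ u ∙ g a ∙ γ t    ≡⟨ assoc (m ∙ γ u) (g a) (γ t) ⟩
      m ∙ γ u ∙ γ (a ∷ t)    ≡⟨ assoc m (γ u) _ ⟩
      m ∙ (γ u ∙ γ (a ∷ t))  ≡⟨ cong (λ s → m ∙ (s ∙ γ (a ∷ t))) γy≡γu ⟨
      m ∙ (γ y ∙ γ (a ∷ t))  ≡⟨ cong (m ∙_) (γ-++ y (a ∷ t)) ⟨
      m ∙ γ (y ++ a ∷ t)     ∎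

    rest′ : ∀ q → length q ℕ.≤ k → q • w′ ≡ q • v′
    rest′ q |q|≤k = trans (sym (•-first q w′ a∉u)) (trans (rest (a ∷ q) (s≤s |q|≤k)) (•-first q v′ a∉x))

    segment′ : ∀ b q → length q ℕ.≤ k → γ∖ b (seg b q w′) ≡ γ∖ b (seg b q v′)
    -- Treated apart because `seg-after` needs a second letter in the extended pattern.
    segment′ b []      _     = cong (γ∖ b) (trans (seg-[] b w′) (sym (seg-[] b v′)))
    segment′ b (c ∷ q) |q|≤k = begin
      γ∖ b (seg b (c ∷ q) w′)                  ≡⟨ cong (γ∖ b) (seg-after b c q w′ a∉u) ⟨
      γ∖ b (seg b (a ∷ c ∷ q) (u ++ a ∷ w′))   ≡⟨ segment b (a ∷ c ∷ q) (s≤s |q|≤k) ⟩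
      γ∖ b (seg b (a ∷ c ∷ q) (x ++ a ∷ v′))   ≡⟨ cong (γ∖ b) (seg-after b c q v′ a∉x) ⟩
      γ∖ b (seg b (c ∷ q) v′)                  ∎

  γ-≼ : ∀ w v → Similar size w v → γ w ≼ γ v
  γ-≼ w v w∼v = subst₂ _≼_ (identityˡ (γ w)) (identityˡ (γ v)) (≼-from size ε (∣p∣≤n (rightIdeal ε)) w∼v)
    where open IsMonoid isMonoid using (identityˡ)

-- The suffix order and Simon's congruence.

infix 4 _⊑_
-- The suffix order, in which remainders of one pattern are compared.
data _⊑_ {n} : List (Fin n) → List (Fin n) → Set where
  whole : ∀ {x} → x ⊑ x
  skip  : ∀ {x y a} → x ⊑ y → x ⊑ a ∷ y

⊑-trans : ∀ {x y z : List (Fin n)} → x ⊑ y → y ⊑ z → x ⊑ z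
⊑-trans x⊑y whole      = x⊑y
⊑-trans x⊑y (skip y⊑z) = skip (⊑-trans x⊑y y⊑z)

⊑-length : ∀ {x y : List (Fin n)} → x ⊑ y → length x ℕ.≤ length y
⊑-length whole      = ℕ.≤-refl
⊑-length (skip x⊑y) = ℕ.m≤n⇒m≤1+n (⊑-length x⊑y)

⊑-antisym : ∀ {x y : List (Fin n)} → x ⊑ y → y ⊑ x → x ≡ y
⊑-antisym whole      _     = refl
⊑-antisym (skip x⊑y) ay⊑x = ⊥-elim (ℕ.<-irrefl refl (ℕ.≤-trans (⊑-length ay⊑x) (⊑-length x⊑y)))

strike-⊑ : ∀ (q : List (Fin n)) b → strike q b ⊑ q
strike-⊑ []      b = whole
strike-⊑ (a ∷ q) b with a Fin.≟ b
... | yes _ = skip whole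
... | no _  = whole

-- A proper suffix of `a ∷ y` is a suffix of `y`, and one strike removes at most `a`.
strike-mono : ∀ {x y : List (Fin n)} b → x ⊑ y → strike x b ⊑ strike y b
strike-mono b whole = whole
strike-mono {x = x} {a ∷ _} b (skip x⊑y) with a Fin.≟ b
... | yes _ = ⊑-trans (strike-⊑ x b) x⊑y
... | no _  = ⊑-trans (strike-⊑ x b) (skip x⊑y)

•-mono : ∀ {x y : List (Fin n)} w → x ⊑ y → x • w ⊑ y • w
•-mono []      x⊑y = x⊑y
•-mono (b ∷ w) x⊑y = •-mono w (strike-mono b x⊑y)

•-⊑ : ∀ (q w : List (Fin n)) → q • w ⊑ q
•-⊑ q []      = whole
•-⊑ q (b ∷ w) = ⊑-trans (•-⊑ (strike q b) w) (strike-⊑ q b)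

•-length : ∀ (q w : List (Fin n)) → length q ℕ.≤ k → length (q • w) ℕ.≤ k
•-length q w = ℕ.≤-trans (⊑-length (•-⊑ q w))

funToFin-cong : ∀ {m n} {f g : Fin m → Fin n} → (∀ i → f i ≡ g i) → funToFin f ≡ funToFin g
funToFin-cong {zero}  f≗g = refl
funToFin-cong {suc m} f≗g = cong₂ Fin.combine (f≗g zero) (funToFin-cong (f≗g ∘ suc))

-- The quotient of A* by Simon's congruence: u and v have the same subwords of length at most k.
module Simon (n k : ℕ) where

  patterns : List (List (Fin n))
  patterns = words n k

  pattern-length : ∀ i → length (lookup patterns i) ℕ.≤ k
  pattern-length i = ∈-words⁻ k (∈-lookup i)

  -- The action of `w` on patterns as a transformation of a finite set: remainders of short patterns
  -- are again short.
  profile : List (Fin n) → Fin (length patterns) → Fin (length patterns)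
  profile w i = index (∈-words k (lookup patterns i • w) (•-length (lookup patterns i) w (pattern-length i)))

  lookup-profile : ∀ w i → lookup patterns (profile w i) ≡ lookup patterns i • w
  lookup-profile w i = sym (Any.lookup-index (∈-words k _ _))

  index-cong : ∀ {x y : List (Fin n)} (p : length x ℕ.≤ k) (p′ : length y ℕ.≤ k) →
               x ≡ y → index (∈-words k x p) ≡ index (∈-words k y p′)
  index-cong p p′ refl = cong (index ∘ ∈-words k _) (ℕ.≤-irrelevant p p′)

  code : List (Fin n) → Fin (length patterns ℕ.^ length patterns)
  code w = funToFin (profile w)

  code⁺ : ∀ u v → (∀ q → length q ℕ.≤ k → q • u ≡ q • v) → code u ≡ code v
  code⁺ u v h = funToFin-cong λ i → index-cong _ _ (h (lookup patterns i) (pattern-length i))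

  code⁻ : ∀ u v → code u ≡ code v → ∀ q → length q ℕ.≤ k → q • u ≡ q • v
  code⁻ u v eq q |q|≤k = begin
    q • u                          ≡⟨ cong (_• u) q≡ ⟩
    lookup patterns i • u          ≡⟨ lookup-profile u i ⟨
    lookup patterns (profile u i)  ≡⟨ cong (lookup patterns) profile≡ ⟩
    lookup patterns (profile v i)  ≡⟨ lookup-profile v i ⟩
    lookup patterns i • v          ≡⟨ cong (_• v) q≡ ⟨
    q • v                          ∎
    where
    open ≡-Reasoning
    i = index (∈-words k q |q|≤k)

    q≡ : q ≡ lookup patterns i
    q≡ = Any.lookup-index (∈-words k q |q|≤k)

    profile≡ : profile u i ≡ profile v i
    profile≡ = begin
      profile u i             ≡⟨ Fin.finToFun-funToFin (profile u) i ⟨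
      finToFun (code u) i     ≡⟨ cong (λ c → finToFun c i) eq ⟩
      finToFun (code v) i     ≡⟨ Fin.finToFun-funToFin (profile v) i ⟩
      profile v i             ∎

  code-cong : ∀ u u′ v v′ → code u ≡ code u′ → code v ≡ code v′ → code (u ++ v) ≡ code (u′ ++ v′)
  code-cong u u′ v v′ u∼ v∼ = code⁺ (u ++ v) (u′ ++ v′) λ q |q|≤k → begin
    q • (u ++ v)    ≡⟨ •-++ q u v ⟩
    q • u • v       ≡⟨ code⁻ v v′ v∼ (q • u) (•-length q u |q|≤k) ⟩
    q • u • v′      ≡⟨ cong (_• v′) (code⁻ u u′ u∼ q |q|≤k) ⟩
    q • u′ • v′     ≡⟨ •-++ q u′ v′ ⟨
    q • (u′ ++ v′)  ∎
    where open ≡-Reasoning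

  open Quotient code code-cong public

  rep-π-• : ∀ w q → length q ℕ.≤ k → q • rep (π w) ≡ q • w
  rep-π-• w = code⁻ (rep (π w)) w (c-rep-π w)

  π-• : ∀ u v → π u ≡ π v → ∀ q → length q ℕ.≤ k → q • u ≡ q • v
  π-• u v eq q |q|≤k =
    trans (sym (rep-π-• u q |q|≤k)) (trans (cong (λ i → q • rep i) eq) (rep-π-• v q |q|≤k))

  open FiniteMonoid quotient using (ideal; _∙_)

  -- A factor read before `t` shortens the pattern that `t` meets, which is harmless by `•-mono`; a
  -- factor read after `t` shortens what is left.
  ideal-⊑ : ∀ {s t} → ideal t s → ∀ q → length q ℕ.≤ k → q • rep s ⊑ q • rep t
  ideal-⊑ {_} {t} (u , v , refl) q |q|≤k =
    subst (_⊑ q • rep t) (sym eq) (⊑-trans (•-⊑ _ (rep v)) (•-mono (rep t) (•-⊑ q (rep u))))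
    where
    open ≡-Reasoning
    eq : q • rep (u ∙ t ∙ v) ≡ q • rep u • rep t • rep v
    eq = begin
      q • rep (u ∙ t ∙ v)              ≡⟨ rep-π-• (rep (u ∙ t) ++ rep v) q |q|≤k ⟩
      q • (rep (u ∙ t) ++ rep v)       ≡⟨ •-++ q (rep (u ∙ t)) (rep v) ⟩
      q • rep (u ∙ t) • rep v          ≡⟨ cong (_• rep v) (rep-π-• (rep u ++ rep t) q |q|≤k) ⟩
      q • (rep u ++ rep t) • rep v     ≡⟨ cong (_• rep v) (•-++ q (rep u) (rep t)) ⟩
      q • rep u • rep t • rep v        ∎

  J-quotient : J quotient
  J-quotient s t (s≤t , t≤s) = begin
    s          ≡⟨ π-rep s ⟨
    π (rep s)  ≡⟨ π-cong (code⁺ (rep s) (rep t) λ q |q|≤k → ⊑-antisym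
                    (ideal-⊑ (s≤t (ideal-refl quotient s)) q |q|≤k) (ideal-⊑ (t≤s (ideal-refl quotient t)) q |q|≤k)) ⟩
    π (rep t)  ≡⟨ π-rep t ⟩
    t          ∎
    where open ≡-Reasoning

-- Submonoids given by generators, as quotients of free monoids.

module Submonoid (M : FiniteMonoid) (g : Fin n → Carrier M) where
  open FiniteMonoid M using (_∙_; monoid; rawMonoid; finite; _^_)

  eval : List (Fin n) → Carrier M
  eval = foldMap rawMonoid g

  eval-++ : ∀ u v → eval (u ++ v) ≡ eval u ∙ eval v
  eval-++ u v = ++-homo monoid g u

  private
    to : Carrier M → Fin (proj₁ finite)
    to = Inverse.to (proj₂ finite)

    to-injective : ∀ {x y} → to x ≡ to y → x ≡ y
    to-injective = ↔-injective (proj₂ finite)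

  open Quotient (to ∘ eval)
    (λ u u′ v v′ u∼ v∼ → cong to (trans (eval-++ u v)
      (trans (cong₂ _∙_ (to-injective u∼) (to-injective v∼)) (sym (eval-++ u′ v′)))))
    public

  open FiniteMonoid quotient
    using ()
    renaming (_∙_ to _∙′_; _^_ to _^′_; rawMonoid to rawMonoid′)

  ι : Carrier quotient → Carrier M
  ι = eval ∘ rep

  ι-π : ∀ w → ι (π w) ≡ eval w
  ι-π w = to-injective (c-rep-π w)

  ι-injective : ∀ {i j} → ι i ≡ ι j → i ≡ j
  ι-injective {i} {j} eq = trans (sym (π-rep i)) (trans (π-cong (cong to eq)) (π-rep j))

  ι-homo : ∀ i j → ι (i ∙′ j) ≡ ι i ∙ ι j
  ι-homo i j = trans (ι-π (rep i ++ rep j)) (eval-++ (rep i) (rep j))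

  ι-^ : ∀ i l → ι (i ^′ l) ≡ ι i ^ l
  ι-^ i zero    = ι-π []
  ι-^ i (suc l) = trans (ι-homo i (i ^′ l)) (cong (ι i ∙_) (ι-^ i l))

  -- The injective homomorphism `ι` preserves powers, hence omega powers, and reflects the identity
  -- of DA.
  DA-quotient : DA M → DA quotient
  DA-quotient da x y z e (ee≡e , l , e≡) = ι-injective (begin
    ι (e ∙′ y ∙′ e)   ≡⟨ ι-homo₃ e y e ⟩
    ι e ∙ ι y ∙ ι e   ≡⟨ da (ι x) (ι y) (ι z) (ι e)
                          ( trans (sym (ι-homo e e)) (cong ι ee≡e)
                          , l
                          , trans (cong ι e≡) (trans (ι-^ _ (suc l)) (cong (_^ suc l) (ι-homo₃ x y z)))) ⟩
    ι e               ∎)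
    where
    open ≡-Reasoning
    ι-homo₃ : ∀ x y z → ι (x ∙′ y ∙′ z) ≡ ι x ∙ ι y ∙ ι z
    ι-homo₃ x y z = trans (ι-homo (x ∙′ y) z) (cong (_∙ ι z) (ι-homo x y))

  π-generated : ∀ w → foldMap rawMonoid′ (λ a → π (a ∷ [])) w ≡ π w
  π-generated []      = refl
  π-generated (a ∷ w) = trans (cong (π (a ∷ []) ∙′_) (π-generated w)) (sym (π-homo (a ∷ []) w))

  generated : GeneratedBy n quotient
  generated = (λ a → π (a ∷ [])) , λ i → rep i , trans (π-generated (rep i)) (π-rep i)

-- Separating relations on words; segments as homomorphisms on contexts.

-- Packages the choice of `K` and `h` in `**`, so that finitely many conditions can be met one at a
-- time and combined by products.
Separated : ∀ n .{{_ : NonZero n}} {A : Set} → (List A → List A → Set) → Set₁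
Separated n {A} R = ∃ λ K → V n K × ∃ λ (h : List A → Carrier K) → IsHom K h × ∀ x y → h x ≡ h y → R x y

separated-∩ : ∀ n {A : Set} {R S : List A → List A → Set} →
  Separated (suc n) R → Separated (suc n) S → Separated (suc n) (λ x y → R x y × S x y)
separated-∩ n (K , VK , h , h-hom , h-sep) (L , VL , l , l-hom , l-sep) =
    K ×ᴹ L , V-× n K L VK VL , (λ x → h x , l x) , pair-hom K L h-hom l-hom
  , λ x y eq → h-sep x y (cong proj₁ eq) , l-sep x y (cong proj₂ eq)

separated-map : ∀ n {A : Set} {R S : List A → List A → Set} →
  (∀ x y → R x y → S x y) → Separated (suc n) R → Separated (suc n) S
separated-map n R⊆S (K , VK , h , h-hom , h-sep) =
  K , VK , h , h-hom , λ x y eq → R⊆S x y (h-sep x y eq)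

separated-All : ∀ n {A I : Set} {R : I → List A → List A → Set} (is : List I) →
  (∀ i → Separated (suc n) (R i)) → Separated (suc n) (λ x y → ∀ {i} → i ∈ is → R i x y)
separated-All n []       sep =
  trivial , V-trivial n , _ , mkHom trivial refl (λ _ _ → refl) , λ _ _ _ ()
separated-All n (i ∷ is) sep = separated-map n
  (λ { x y (r , rs) (here refl) → r ; x y (r , rs) (there i∈) → rs i∈ })
  (separated-∩ n (sep i) (separated-All n is sep))

-- τ ψ = contexts ψ ψ; separate functions allow a fixed prefix to be absorbed into α.
contexts : {A N : Set} → (List A → N) → (List A → N) → List A → List (N × A × N)
contexts α β w = tabulate λ (i : Fin (length w)) →
  α (take (toℕ i) w) , lookup w i , β (drop (suc (toℕ i)) w)

module _ {A N : Set} (f : A → List (Fin (suc n))) (a : Fin (suc n)) (q : List (Fin (suc n)))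
  (G : N × A × N → List (Fin n)) (β : List A → N) where

  -- What a letter contributes to a segment depends on the prefix before it. If the context reveals
  -- what that prefix leaves of `q`, the contribution is read off the context letter alone, and the
  -- segment becomes a homomorphism.
  concatMap-seg : (α : List A → N) → (∀ u x t → G (α u , x , t) ≡ seg a (q • concatMap f u) (f x)) →
    ∀ w → concatMap G (contexts α β w) ≡ seg a q (concatMap f w)
  concatMap-seg = go q
    where
    go : ∀ p (α : List A → N) → (∀ u x t → G (α u , x , t) ≡ seg a (p • concatMap f u) (f x)) →
         ∀ w → concatMap G (contexts α β w) ≡ seg a p (concatMap f w)
    go p α hyp []      = refl
    -- The first letter joins the prefix, so both the pattern and `α` must vary in the induction.
    go p α hyp (x ∷ w) = trans
      (cong₂ _++_ (hyp [] x (β w)) (go (p • f x) (α ∘ (x ∷_))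
        (λ u y t → trans (hyp (x ∷ u) y t) (cong (λ p → seg a p (f y)) (•-++ p (f x) (concatMap f u)))) w))
      (sym (seg-++ a p (f x) (concatMap f w)))

  -- Dropping the first letter leaves the suffixes after the other letters unchanged, so the pattern
  -- stays fixed in the induction.
  concatMap-rseg : (∀ s x u → G (s , x , β u) ≡ rseg a (q • reverse (concatMap f u)) (f x)) →
    ∀ (α : List A → N) w → concatMap G (contexts α β w) ≡ rseg a q (concatMap f w)
  concatMap-rseg hyp α []      = refl
  concatMap-rseg hyp α (x ∷ w) = trans
    (cong₂ _++_ (hyp (α []) x w) (concatMap-rseg hyp (α ∘ (x ∷_)) w))
    (sym (rseg-++ a q (f x) (concatMap f w)))

foldMap-op : ∀ (M : FiniteMonoid) (g : A → Carrier M) w →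
  foldMap (FiniteMonoid.rawMonoid (op M)) g (reverse w) ≡ foldMap (FiniteMonoid.rawMonoid M) g w
foldMap-op M g []      = refl
foldMap-op M g (a ∷ w) = begin
  foldMap Mᵒ.rawMonoid g (reverse (a ∷ w))                            ≡⟨ cong (foldMap Mᵒ.rawMonoid g) (unfold-reverse a w) ⟩
  foldMap Mᵒ.rawMonoid g (reverse w ++ a ∷ [])                        ≡⟨ ++-homo Mᵒ.monoid g (reverse w) ⟩
  ε ∙ g a ∙ foldMap Mᵒ.rawMonoid g (reverse w)                        ≡⟨ cong₂ _∙_ (IsMonoid.identityˡ isMonoid (g a)) (foldMap-op M g w) ⟩
  g a ∙ foldMap rawMonoid g w                                         ∎
  where
  open ≡-Reasoning
  open FiniteMonoid M hiding (Carrier)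
  module Mᵒ = FiniteMonoid (op M)

foldMap-map : ∀ {B : Set} (M : FiniteMonoid) (g : B → Carrier M) (r : A → B) w →
  foldMap (FiniteMonoid.rawMonoid M) g (map r w) ≡ foldMap (FiniteMonoid.rawMonoid M) (g ∘ r) w
foldMap-map M g r []      = refl
foldMap-map M g r (a ∷ w) = cong (FiniteMonoid._∙_ M (g (r a))) (foldMap-map M g r w)

-- The induction step.

module Step (n : ℕ) (M : FiniteMonoid) (da : DA M) (g : Fin (suc (suc n)) → Carrier M)
  (g-generates : ∀ m → ∃ λ w → foldMap (FiniteMonoid.rawMonoid M) g w ≡ m)
  (V-submonoid : ∀ a → V (suc n) (Submonoid.quotient M (g ∘ punchIn a)))
  where
  open FiniteMonoid M hiding (Carrier)
  open IsMonoid isMonoid using (assoc)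
  open DATheory using (DA⇒RStable; DA⇒LStable; DA⇒H-trivial)

  module Left  = Factorization M g (DA⇒RStable M da)
  -- In `op M` the product of `x`, `b`, `y` reads `y ∙ (b ∙ x)` in `M`, hence the exchange of `x`
  -- and `y`.
  module Right = Factorization (op M) g (λ u x b y fix →
    DA⇒LStable M da u y b x (trans (cong (_∙ u) (assoc y b x)) fix))
  open Left using (γ; γ-++; size)
  module S = Simon (suc (suc n)) size
  module Sub (a : Fin (suc (suc n))) = Submonoid M (g ∘ punchIn a)

  Left-∼ : List (Fin (suc (suc n))) → List (Fin (suc (suc n))) → Set
  Left-∼ v w = ∀ a q → length q ℕ.≤ size → Sub.π a (seg a q v) ≡ Sub.π a (seg a q w)

  Right-∼ : List (Fin (suc (suc n))) → List (Fin (suc (suc n))) → Set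
  Right-∼ v w = ∀ a q → length q ℕ.≤ size → Sub.π a (rseg a q v) ≡ Sub.π a (rseg a q w)

  π⇒γ : ∀ a {u v} → Sub.π a u ≡ Sub.π a v → γ (map (punchIn a) u) ≡ γ (map (punchIn a) v)
  π⇒γ a {u} {v} eq = begin
    γ (map (punchIn a) u)  ≡⟨ foldMap-map M g (punchIn a) u ⟩
    Sub.eval a u           ≡⟨ Sub.ι-π a u ⟨
    Sub.ι a (Sub.π a u)    ≡⟨ cong (Sub.ι a) eq ⟩
    Sub.ι a (Sub.π a v)    ≡⟨ Sub.ι-π a v ⟩
    Sub.eval a v           ≡⟨ foldMap-map M g (punchIn a) v ⟨
    γ (map (punchIn a) v)  ∎
    where open ≡-Reasoning

  left-≼ : ∀ v w → S.π v ≡ S.π w → Left-∼ v w → ∃ λ z → γ v ∙ z ≡ γ w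
  left-≼ v w π-eq l∼ = Left.γ-≼ v w record
    { rest    = S.π-• v w π-eq
    ; segment = λ a q |q|≤ → π⇒γ a (l∼ a q |q|≤)
    }

  -- The left-hand result for reversed words in `op M`, where by `foldMap-op` they have the values
  -- of the original words in `M`.
  right-≼ : ∀ v w → S.π (reverse v) ≡ S.π (reverse w) → Right-∼ v w → ∃ λ z → z ∙ γ v ≡ γ w
  right-≼ v w π-eq r∼ = map₂ (subst₂ (λ x y → _ ∙ x ≡ y) (foldMap-op M g v) (foldMap-op M g w))
    (Right.γ-≼ (reverse v) (reverse w) record
      { rest    = S.π-• (reverse v) (reverse w) π-eq
      ; segment = λ a q |q|≤ → trans (rseg-op a q v) (trans (π⇒γ a (r∼ a q |q|≤)) (sym (rseg-op a q w)))
      })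
    where
    rseg-op : ∀ a q u → Right.γ (map (punchIn a) (seg a q (reverse u))) ≡ γ (map (punchIn a) (rseg a q u))
    rseg-op a q u = begin
      Right.γ (map (punchIn a) s)                      ≡⟨ cong Right.γ (reverse-involutive (map (punchIn a) s)) ⟨
      Right.γ (reverse (reverse (map (punchIn a) s)))  ≡⟨ foldMap-op M g (reverse (map (punchIn a) s)) ⟩
      γ (reverse (map (punchIn a) s))                  ≡⟨ cong γ (reverse-map (punchIn a) s) ⟨
      γ (map (punchIn a) (reverse s))                  ∎
      where
      open ≡-Reasoning
      s = seg a q (reverse u)

  γ-≡ : ∀ v w → S.π v ≡ S.π w → S.π (reverse v) ≡ S.π (reverse w) → Left-∼ v w → Right-∼ v w → γ v ≡ γ w
  γ-≡ v w l≡ r≡ l∼ r∼ = DA⇒H-trivial M da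
    (sym (proj₂ (left-≼ w v (sym l≡) (λ a q |q|≤ → sym (l∼ a q |q|≤)))))
    (sym (proj₂ (left-≼ v w l≡ l∼)))
    (sym (proj₂ (right-≼ w v (sym r≡) (λ a q |q|≤ → sym (r∼ a q |q|≤)))))

  ∈V** : V (suc (suc n)) M
  ∈V** A A-fin φ φ-hom φ-surj =
      N , J-× S.quotient (op S.quotient) S.J-quotient (J-op S.quotient S.J-quotient)
    , ψ , pair-hom S.quotient (op S.quotient)
        (mkHom S.quotient refl λ u v → trans (cong S.π (f*-++ u v)) (S.π-homo _ _))
        (mkHom (op S.quotient) refl λ u v →
          trans (cong S.π (trans (cong reverse (f*-++ u v)) (reverse-++ (f* u) (f* v)))) (S.π-homo _ _))
    , (let K , VK , h , h-hom , sep = τ-separated in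
       K , VK , h , h-hom , λ v w ψ-eq h-eq →
         let l∼ , r∼ = sep (τ ψ v) (τ ψ w) h-eq v w refl refl in
         subst₂ _≡_ (γ-f* v) (γ-f* w) (γ-≡ (f* v) (f* w) (cong proj₁ ψ-eq) (cong proj₂ ψ-eq) l∼ r∼))
    where
    -- `**` ranges over all surjections `φ`, so each letter of `A` is first rewritten as a word over
    -- the generators with the same value.
    f : A → List (Fin (suc (suc n)))
    f x = proj₁ (g-generates (φ (x ∷ [])))

    f* : List A → List (Fin (suc (suc n)))
    f* = concatMap f

    f*-++ : ∀ u v → f* (u ++ v) ≡ f* u ++ f* v
    f*-++ = concatMap-++ f

    γ-f* : ∀ w → γ (f* w) ≡ φ w
    γ-f* []      = sym (Hom.ε-homo M φ-hom)
    γ-f* (x ∷ w) = begin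
      γ (f x ++ f* w)       ≡⟨ γ-++ (f x) (f* w) ⟩
      γ (f x) ∙ γ (f* w)    ≡⟨ cong₂ _∙_ (proj₂ (g-generates (φ (x ∷ [])))) (γ-f* w) ⟩
      φ (x ∷ []) ∙ φ w      ≡⟨ Hom.homo M φ-hom (x ∷ []) w ⟨
      φ (x ∷ w)             ∎
      where open ≡-Reasoning

    -- The first factor reads a word, the second its reversal, hence `op`. A letter of `Σ` thus
    -- knows how far a pattern is matched by the prefix from the left and by the suffix from the
    -- right.
    N : FiniteMonoid
    N = S.quotient ×ᴹ op S.quotient

    ψ : List A → Carrier N
    ψ w = S.π (f* w) , S.π (reverse (f* w))

    Σ : Set
    Σ = Carrier N × A × Carrier N

    -- A context gives only a class of words, but all its members leave the same remainder of a
    -- pattern of length at most `size`.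
    segˡ rsegʳ : Fin (suc (suc n)) → List (Fin (suc (suc n))) → Σ → List (Fin (suc n))
    segˡ  a q ((s , _) , x , _) = seg  a (q • S.rep s) (f x)
    rsegʳ a q (_ , x , (_ , t)) = rseg a (q • S.rep t) (f x)

    concatMap-segˡ : ∀ a q → length q ℕ.≤ size → ∀ w → concatMap (segˡ a q) (τ ψ w) ≡ seg a q (f* w)
    concatMap-segˡ a q |q|≤ = concatMap-seg f a q (segˡ a q) ψ ψ
      λ u x t → cong (λ p → seg a p (f x)) (S.rep-π-• (f* u) q |q|≤)

    concatMap-rsegʳ : ∀ a q → length q ℕ.≤ size → ∀ w → concatMap (rsegʳ a q) (τ ψ w) ≡ rseg a q (f* w)
    concatMap-rsegʳ a q |q|≤ = concatMap-rseg f a q (rsegʳ a q) ψ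
      (λ s x u → cong (λ p → rseg a p (f x)) (S.rep-π-• (reverse (f* u)) q |q|≤)) ψ

    Agree : (Fin (suc (suc n)) → List (Fin (suc (suc n))) → Σ → List (Fin (suc n))) → List Σ → List Σ → Set
    Agree G x y = ∀ {a} → a ∈ allFin (suc (suc n)) → ∀ {q} → q ∈ words (suc (suc n)) size →
      Sub.π a (concatMap (G a q) x) ≡ Sub.π a (concatMap (G a q) y)

    -- The induction hypothesis enters here: for fixed `a` and `q` the value lies in a submonoid
    -- generated without `a`, which belongs to `V (suc n)`.
    separated-Agree : ∀ G → Separated (suc n) (Agree G)
    separated-Agree G = separated-All n (allFin (suc (suc n))) λ a → separated-All n (words (suc (suc n)) size) λ q →
      Sub.quotient a , V-submonoid a , Sub.π a ∘ concatMap (G a q)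
      , mkHom (Sub.quotient a) refl (λ u v → trans (cong (Sub.π a) (concatMap-++ (G a q) u v)) (Sub.π-homo a _ _))
      , λ _ _ → id

    -- `Separated` needs a relation on all words over `Σ`; this one constrains only those of the
    -- form `τ ψ v`.
    τ-separated : Separated (suc n) (λ x y → ∀ v w → x ≡ τ ψ v → y ≡ τ ψ w →
      Left-∼ (f* v) (f* w) × Right-∼ (f* v) (f* w))
    τ-separated = separated-map n
      (λ { _ _ (l∼ , r∼) v w refl refl →
          (λ a q |q|≤ → subst₂ (λ x y → Sub.π a x ≡ Sub.π a y)
            (concatMap-segˡ a q |q|≤ v) (concatMap-segˡ a q |q|≤ w)
            (l∼ (∈-allFin a) (∈-words size q |q|≤)))
        , (λ a q |q|≤ → subst₂ (λ x y → Sub.π a x ≡ Sub.π a y)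
            (concatMap-rsegʳ a q |q|≤ v) (concatMap-rsegʳ a q |q|≤ w)
            (r∼ (∈-allFin a) (∈-words size q |q|≤)))
      })
      (separated-∩ n (separated-Agree segˡ) (separated-Agree rsegʳ))

-- The case of one generator, and the induction.

++-comm₁ : ∀ (u v : List (Fin 1)) → u ++ v ≡ v ++ u
++-comm₁ u []         = ++-identityʳ u
++-comm₁ u (zero ∷ v) = trans (shift u) (cong (zero ∷_) (++-comm₁ u v))
  where
  shift : ∀ u → u ++ zero ∷ v ≡ zero ∷ u ++ v
  shift []         = refl
  shift (zero ∷ u) = cong (zero ∷_) (shift u)

-- With one generator the monoid is commutative, so two-sided factorizations become one-sided and
-- J-equivalent elements are H-equivalent.
DA∧monogenic⇒J : ∀ M → DA M → GeneratedBy 1 M → J M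
DA∧monogenic⇒J M da (g , g-generates) s t (s≤t , t≤s)
  with u , v , s≡utv ← s≤t (ideal-refl M s) | u′ , v′ , t≡u′sv′ ← t≤s (ideal-refl M t)
  = DATheory.DA⇒H-trivial M da (factor s≡utv) (factor t≡u′sv′)
      (trans (factor s≡utv) (comm t (u ∙ v)))
  where
  open FiniteMonoid M hiding (Carrier)
  open IsMonoid isMonoid using (assoc)

  comm : ∀ x y → x ∙ y ≡ y ∙ x
  comm x y with p , refl ← g-generates x | q , refl ← g-generates y =
    trans (sym (++-homo monoid g p)) (trans (cong (foldMap rawMonoid g) (++-comm₁ p q)) (++-homo monoid g q))

  factor : ∀ {x y u v} → x ≡ u ∙ y ∙ v → x ≡ y ∙ (u ∙ v)
  factor {y = y} {u} {v} eq = trans eq (trans (cong (_∙ v) (comm u y)) (assoc y u v))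

-- Composing `g` with `punchIn a` omits one generator, and the submonoid stays in DA.
DA⇒V : ∀ n M → DA M → GeneratedBy (suc n) M → V (suc n) M
DA⇒V zero    M da gen               = lift (DA∧monogenic⇒J M da gen)
DA⇒V (suc n) M da (g , g-generates) = Step.∈V** n M da g g-generates λ a →
  DA⇒V n (Submonoid.quotient M (g ∘ punchIn a)) (Submonoid.DA-quotient M (g ∘ punchIn a) da)
    (Submonoid.generated M (g ∘ punchIn a))

theorem5p1 : (n : ℕ) .{{_ : NonZero n}} (M : FiniteMonoid) →
    DA M → GeneratedBy n M → V n M
theorem5p1 (suc n) = DA⇒V n
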